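{- Let $n$ be a positive integer and let $a,b$ be distinct integers with $0<a,b<n$, so that $G=C_{2n}(a,b,n)$ is a $5$-regular circulant graph. Suppose there exists a generator $g$ of the cyclic group $(\mathbb{Z}_{2n},+)$ such that, writing $a=p\cdot g$ and $b=q\cdot g$ with $p,q\in\{0,1,\dots,2n-1\}$ (i.e. $pg\equiv a$ and $qg\equiv b \pmod{2n}$), the number $r=\min\{p,q,2n-p,2n-q\}$ satisfies $r\geq \lceil \tfrac{2n}{3}\rceil$. Then $G$ is word-representable.
   Context: Two distinct letters $x,y$ alternate in a word $w$ if, after deleting all other letters from $w$, the resulting word is of the form $xyxy\cdots$ or $yxyx\cdots$ (of even or odd length). A graph $G=(V,E)$ is word-representable if there is a word $w$ over the alphabet $V$, containing every letter of $V$ at least once, such that for all distinct $x,y\in V$, $xy\in E$ if and only if $x$ and $y$ alternate in $w$. For an integer $m$ and a set $R$ of positive integers each at most $m/2$, the circulant graph $C_m(R)$ has vertex set $\{0,1,\dots,m-1\}$, with $i$ and $j$ adjacent iff $\min(|i-j|,\,m-|i-j|)\in R$. $C_{2n}(a,b,n)$ denotes the circulant graph on $2n$ vertices with jump set $\{a,b,n\}$. For an integer $k$ and $g\in\mathbb{Z}_{2n}$, $k\cdot g$ denotes the $k$-fold sum of $g$ in $\mathbb{Z}_{2n}$. -}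

module Defs where

open import Algebra.Bundles using (AbelianGroup; Group)
import Algebra.Definitions.RawMonoid as RawMonoidDefinitions
open import Data.Fin.Base using (Fin; toℕ)
open import Data.Fin.Properties
  using (_≟_; toℕ-injective; toℕ-fromℕ<; toℕ<n; toℕ≤n)
open import Data.Integer.Base using (ℤ; +_; -[1+_])
open import Data.List.Base using (List; []; _∷_; filter)
open import Data.List.Membership.Propositional using (_∈_)
open import Data.Nat.Base
open import Data.Nat.DivMod
open import Data.Nat.Properties
  using (+-comm; +-assoc; m∸n+n≡m; ∣-∣-comm; ∣n-n∣≡0; m*n≢0;
         <-irrefl; <⇒≤; *-monoʳ-≤; ≤-refl; <-trans)
open import Data.Product.Base using (_×_; _,_; ∃; proj₁)
open import Data.Sum.Base using (_⊎_; inj₁; inj₂)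
open import Function.Bundles using (_⇔_)
open import Level using (0ℓ)
open import Relation.Binary.Core using (Rel)
open import Relation.Binary.Definitions using (Symmetric)
open import Relation.Binary.PropositionalEquality
open import Relation.Nullary using (¬_)
open import Relation.Nullary.Decidable using (_⊎-dec_)
open import Relation.Unary using (Pred; ｛_｝; _∪_; _⊆_)

record Graph : Set₁ where
  field
    order    : ℕ
    _~_      : Rel (Fin order) 0ℓ
    ~-sym    : Symmetric _~_
    ~-irrefl : ∀ {x} → ¬ (x ~ x)

-- The words xyxy⋯ beginning with x, of any length.
data AlternatingFrom {A : Set} : A → A → List A → Set where
  []  : ∀ {x y} → AlternatingFrom x y []
  _∷_ : ∀ x {y w} → AlternatingFrom y x w → AlternatingFrom x y (x ∷ w)

module _ {k : ℕ} where

  restrict : Fin k → Fin k → List (Fin k) → List (Fin k)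
  restrict x y = filter (λ z → (z ≟ x) ⊎-dec (z ≟ y))

  Alternate : Fin k → Fin k → List (Fin k) → Set
  Alternate x y w =
    AlternatingFrom x y (restrict x y w) ⊎ AlternatingFrom y x (restrict x y w)

WordRepresentable : Graph → Set
WordRepresentable G =
  ∃ λ (w : List (Fin order)) →
    (∀ v → v ∈ w) ×
    (∀ x y → x ≢ y → (x ~ y ⇔ Alternate x y w))
  where open Graph G

circularDistance : (m : ℕ) → Fin m → Fin m → ℕ
circularDistance m i j = ∣ toℕ i - toℕ j ∣ ⊓ (m ∸ ∣ toℕ i - toℕ j ∣)

IsJump : ℕ → Pred ℕ 0ℓ
IsJump m r = 0 < r × 2 * r ≤ m

circulant : (m : ℕ) (R : Pred ℕ 0ℓ) → R ⊆ IsJump m → Graph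
circulant m R R⊆ = record
  { order    = m
  ; _~_      = λ i j → R (circularDistance m i j)
  ; ~-sym    = λ {i} {j} →
      subst (λ d → R (d ⊓ (m ∸ d))) (∣-∣-comm (toℕ i) (toℕ j))
  ; ~-irrefl = λ {i} Rii → <-irrefl refl
      (subst (λ d → 0 < d ⊓ (m ∸ d)) (∣n-n∣≡0 (toℕ i)) (proj₁ (R⊆ Rii)))
  }

C₂ₙ : (n a b : ℕ) → 0 < a → a < n → 0 < b → b < n → Graph
C₂ₙ n a b 0<a a<n 0<b b<n =
  circulant (2 * n) (｛ a ｝ ∪ ｛ b ｝ ∪ ｛ n ｝) λ where
    (inj₁ refl)        → 0<a , *-monoʳ-≤ 2 (<⇒≤ a<n)
    (inj₂ (inj₁ refl)) → 0<b , *-monoʳ-≤ 2 (<⇒≤ b<n)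
    (inj₂ (inj₂ refl)) → <-trans 0<a a<n , ≤-refl

module _ (m : ℕ) .{{_ : NonZero m}} where

  private
    _⊕_ : Fin m → Fin m → Fin m
    i ⊕ j = (toℕ i + toℕ j) mod m

    ⊖_ : Fin m → Fin m
    ⊖ i = (m ∸ toℕ i) mod m

    𝟘 : Fin m
    𝟘 = 0 mod m

    toℕ-mod : ∀ k → toℕ (k mod m) ≡ k % m
    toℕ-mod k = toℕ-fromℕ< (m%n<n k m)

    mod-toℕ : ∀ i → toℕ i mod m ≡ i
    mod-toℕ i = toℕ-injective (trans (toℕ-mod (toℕ i)) (m<n⇒m%n≡m (toℕ<n i)))

    mod-cong : ∀ {k l} → k % m ≡ l % m → k mod m ≡ l mod m
    mod-cong {k} {l} eq =
      toℕ-injective (trans (toℕ-mod k) (trans eq (sym (toℕ-mod l))))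

    mod-+ˡ : ∀ k l → (toℕ (k mod m) + l) mod m ≡ (k + l) mod m
    mod-+ˡ k l = mod-cong (begin
      (toℕ (k mod m) + l) % m  ≡⟨ cong (λ z → (z + l) % m) (toℕ-mod k) ⟩
      (k % m + l) % m          ≡⟨ %-distribˡ-+ (k % m) l m ⟩
      (k % m % m + l % m) % m  ≡⟨ cong (λ z → (z + l % m) % m) (m%n%n≡m%n k m) ⟩
      (k % m + l % m) % m      ≡⟨ %-distribˡ-+ k l m ⟨
      (k + l) % m              ∎)
      where open ≡-Reasoning

    ⊕-comm : ∀ i j → i ⊕ j ≡ j ⊕ i
    ⊕-comm i j = cong (_mod m) (+-comm (toℕ i) (toℕ j))

    ⊕-assoc : ∀ i j k → (i ⊕ j) ⊕ k ≡ i ⊕ (j ⊕ k)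
    ⊕-assoc i j k = begin
      (i ⊕ j) ⊕ k                        ≡⟨ mod-+ˡ (toℕ i + toℕ j) (toℕ k) ⟩
      (toℕ i + toℕ j + toℕ k) mod m      ≡⟨ cong (_mod m) (+-assoc (toℕ i) _ _) ⟩
      (toℕ i + (toℕ j + toℕ k)) mod m    ≡⟨ cong (_mod m) (+-comm (toℕ i) _) ⟩
      (toℕ j + toℕ k + toℕ i) mod m      ≡⟨ mod-+ˡ (toℕ j + toℕ k) (toℕ i) ⟨
      (j ⊕ k) ⊕ i                        ≡⟨ ⊕-comm (j ⊕ k) i ⟩
      i ⊕ (j ⊕ k)                        ∎
      where open ≡-Reasoning

    ⊕-identityˡ : ∀ i → 𝟘 ⊕ i ≡ i
    ⊕-identityˡ i = trans (mod-+ˡ 0 (toℕ i)) (mod-toℕ i)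

    ⊕-inverseˡ : ∀ i → (⊖ i) ⊕ i ≡ 𝟘
    ⊕-inverseˡ i = begin
      (⊖ i) ⊕ i                      ≡⟨ mod-+ˡ (m ∸ toℕ i) (toℕ i) ⟩
      (m ∸ toℕ i + toℕ i) mod m      ≡⟨ cong (_mod m) (m∸n+n≡m (toℕ≤n i)) ⟩
      m mod m                        ≡⟨ mod-cong (trans (n%n≡0 m) (sym (m<n⇒m%n≡m (>-nonZero⁻¹ m)))) ⟩
      𝟘                              ∎
      where open ≡-Reasoning

  ℤ/_ : AbelianGroup 0ℓ 0ℓ
  ℤ/_ = record
    { Carrier = Fin m
    ; _≈_     = _≡_
    ; _∙_     = _⊕_
    ; ε       = 𝟘
    ; _⁻¹     = ⊖_
    ; isAbelianGroup = record
      { isGroup = record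
        { isMonoid = record
          { isSemigroup = record
            { isMagma = record
              { isEquivalence = isEquivalence
              ; ∙-cong        = cong₂ _⊕_
              }
            ; assoc = ⊕-assoc
            }
          ; identity = ⊕-identityˡ , λ i → trans (⊕-comm i 𝟘) (⊕-identityˡ i)
          }
        ; inverse = ⊕-inverseˡ , λ i → trans (⊕-comm i (⊖ i)) (⊕-inverseˡ i)
        ; ⁻¹-cong = cong ⊖_
        }
      ; comm = ⊕-comm
      }
    }

module Multiples {c ℓ} (G : Group c ℓ) where
  open Group G
  open RawMonoidDefinitions rawMonoid using () renaming (_×_ to _×ℕ_)

  infixr 8 _·_

  _·_ : ℤ → Carrier → Carrier
  (+ k)    · g = k ×ℕ g
  -[1+ k ] · g = (suc k ×ℕ g) ⁻¹

  IsGenerator : Carrier → Set _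
  IsGenerator g = ∀ h → ∃ λ k → k · g ≈ h

module ℤ₂ₙ (n : ℕ) .{{_ : NonZero n}} where
  open AbelianGroup (ℤ/_ (2 * n) {{m*n≢0 2 n}}) public using (Carrier; group)
  open Multiples group public

⌈_/_⌉ : (k d : ℕ) .{{_ : NonZero d}} → ℕ
⌈ k / d ⌉ = (k + (d ∸ 1)) / d

{-# OPTIONS --safe #-}

-- Let u be the inverse of g modulo 2n and read each vertex v in the coordinate
-- uv mod 2n. All jumps a, b, n become residues at distance at least
-- t = ⌈2n/3⌉ from 0, so the three arcs [0,t), [t,2t), [2t,2n) are independent
-- sets and G is 3-colourable.
--
-- A 3-colourable graph is word-representable: let V₀, V₁, V₂ enumerate the
-- colour classes and concatenate "rounds" V₀ V₁ V₂. Adjacent letters alternate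
-- in any such word, lower colour first, however the classes are ordered in each
-- round. It remains to produce, for every non-adjacent pair x, y, a word of this
-- kind in which x and y do not alternate. If they have the same colour, reverse
-- their order from one round to the next. Otherwise their colours are
-- consecutive in the cyclic order 0 1 2 0 (there are only three), say x first;
-- place x last in its class and y first in the class that follows, and exchange
-- these two neighbouring letters: only the pair x, y notices.
module Submission where

open import Defs
open import Data.Fin.Base as Fin using (Fin; toℕ; fromℕ<)
open import Data.Fin.Patterns using (0F; 1F; 2F)
import Data.Fin.Properties as Fin
open import Data.Integer.Base as ℤ using (ℤ; +_; -[1+_])
open import Data.Integer.Divisibility.Signed
  using (_∣_; divides; ∣⇒∣ᵤ; ∣m∣n⇒∣m+n; ∣m∣n⇒∣m-n; ∣n⇒∣m*n)
import Data.Integer.DivMod as ℤ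
import Data.Integer.Properties as ℤ
import Data.Integer.Tactic.RingSolver as ℤ-Solver
open import Data.List.Base
  using (List; []; _∷_; _++_; _∷ʳ_; filter; allFin; cartesianProduct)
open import Data.List.Membership.Propositional using (_∈_; _∉_)
open import Data.List.Membership.Propositional.Properties
  using (∈-∃++; ∈-filter⁺; ∈-filter⁻; ∈-allFin; ∈-cartesianProduct⁺; ∈-++⁺ˡ; ∈-++⁺ʳ)
open import Data.List.Properties
  using (filter-++; filter-none; filter-accept; filter-≐; ∷ʳ-++)
open import Data.List.Relation.Binary.Permutation.Propositional
  using (_↭_; refl; prep; swap; ↭-sym; ↭⇒↭ₛ)
open import Data.List.Relation.Binary.Permutation.Propositional.Properties
  using (∈-resp-↭; shift; ∷↭∷ʳ)
import Data.List.Relation.Binary.Permutation.Setoid.Properties as Permutation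
open import Data.List.Relation.Unary.All as All using ([]; _∷_)
open import Data.List.Relation.Unary.Any using (here; there)
open import Data.List.Relation.Unary.Unique.Propositional using (Unique; []; _∷_)
import Data.List.Relation.Unary.Unique.Propositional.Properties as Unique
open import Data.Nat.Base
open import Data.Nat.Divisibility using (∣1⇒≡1)
open import Data.Nat.DivMod
  using (_mod_; m%n<n; m≡m%n+[m/n]*n; m<n*o⇒m/o<n)
open import Data.Nat.Properties
open import Data.Product.Base using (_×_; _,_; ∃; ∃₂; proj₁; proj₂)
open import Data.Sum.Base as Sum using (_⊎_; inj₁; inj₂; [_,_]′)
open import Function.Base using (_∘_)
open import Function.Bundles using (_⇔_; mk⇔)
open import Level using (0ℓ)
open import Relation.Binary.Definitions using (Decidable; tri<; tri≈; tri>)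
open import Relation.Binary.PropositionalEquality
open import Relation.Nullary using (¬_; yes; no; contradiction)
open import Relation.Nullary.Decidable using (_⊎-dec_)
import Relation.Unary as Unary

-- Alternating and stuttering words.

module _ {A : Set} where

  -- Alternating words of even length with a fixed first letter. Unlike alternation in general, this
  -- property survives concatenation, so words can be built block by block.
  data Rounds (u v : A) : List A → Set where
    []    : Rounds u v []
    round : ∀ {w} → Rounds u v w → Rounds u v (u ∷ v ∷ w)

  Rounds-++ : ∀ {u v s t} → Rounds u v s → Rounds u v t → Rounds u v (s ++ t)
  Rounds-++ []        t = t
  Rounds-++ (round s) t = round (Rounds-++ s t)

  Rounds⇒AlternatingFrom : ∀ {u v w} → Rounds u v w → AlternatingFrom u v w
  Rounds⇒AlternatingFrom []        = []
  Rounds⇒AlternatingFrom (round r) = _ ∷ (_ ∷ Rounds⇒AlternatingFrom r)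

  -- A repeated neighbour is a positive certificate of non-alternation, and it persists when
  -- anything is put before or after the word.
  data Stutters : List A → Set where
    here  : ∀ {z w} → Stutters (z ∷ z ∷ w)
    there : ∀ {z w} → Stutters w → Stutters (z ∷ w)

  Stutters-++ˡ : ∀ s {t} → Stutters t → Stutters (s ++ t)
  Stutters-++ˡ []      σ = σ
  Stutters-++ˡ (_ ∷ s) σ = there (Stutters-++ˡ s σ)

  Stutters-++ʳ : ∀ {s} t → Stutters s → Stutters (s ++ t)
  Stutters-++ʳ t here      = here
  Stutters-++ʳ t (there σ) = there (Stutters-++ʳ t σ)

  Stutters⇒¬AlternatingFrom :
    ∀ {x y w} → x ≢ y → Stutters w → ¬ AlternatingFrom x y w
  Stutters⇒¬AlternatingFrom x≢y here      (_ ∷ (_ ∷ _)) = x≢y refl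
  Stutters⇒¬AlternatingFrom x≢y (there σ) (_ ∷ α) =
    Stutters⇒¬AlternatingFrom (x≢y ∘ sym) σ α

  filter-swap : ∀ {P : Unary.Pred A 0ℓ} (P? : Unary.Decidable P) {x y} w →
    ¬ (P x × P y) → filter P? (x ∷ y ∷ w) ≡ filter P? (y ∷ x ∷ w)
  filter-swap P? {x} {y} w ¬both with P? x in eqx | P? y in eqy
  ... | yes Px | yes Py = contradiction (Px , Py) ¬both
  ... | yes Px | no _ rewrite eqx | eqy = refl
  ... | no _ | yes _ rewrite eqx | eqy = refl
  ... | no _ | no _  rewrite eqx | eqy = refl

  Unique-constant : ∀ {x : A} {w} →
    Unique w → x ∈ w → (∀ {y} → y ∈ w → y ≡ x) → w ≡ x ∷ []
  Unique-constant {w = y ∷ []} _ _ const = cong (_∷ []) (const (here refl))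
  Unique-constant {w = y ∷ z ∷ _} ((y≢z ∷ _) ∷ _) _ const =
    contradiction (trans (const (here refl)) (sym (const (there (here refl))))) y≢z

-- Restriction of a word to two letters.

module _ {k : ℕ} where

  either? : ∀ (x y : Fin k) → Unary.Decidable (λ z → z ≡ x ⊎ z ≡ y)
  either? x y z = (z Fin.≟ x) ⊎-dec (z Fin.≟ y)

  restrict-++ : ∀ (x y : Fin k) s t →
    restrict x y (s ++ t) ≡ restrict x y s ++ restrict x y t
  restrict-++ x y = filter-++ _

  restrict-swap-letters : ∀ (x y : Fin k) w → restrict x y w ≡ restrict y x w
  restrict-swap-letters x y = filter-≐ _ _ (Sum.swap , Sum.swap)

  restrict-∷ʳ : ∀ (x y : Fin k) w → restrict x y (y ∷ w) ≡ y ∷ restrict x y w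
  restrict-∷ʳ x y w = filter-accept _ {xs = w} (inj₂ refl)

  restrict-none : ∀ {x y : Fin k} {w} → x ∉ w → y ∉ w → restrict x y w ≡ []
  restrict-none {x} {y} x∉ y∉ = filter-none (either? x y)
    (All.tabulate λ z∈ → λ { (inj₁ refl) → x∉ z∈ ; (inj₂ refl) → y∉ z∈ })

  -- Filtering keeps the list free of duplicates, and every letter that survives equals `x`, so
  -- exactly one survives.
  restrict-onlyˡ : ∀ {x y : Fin k} {w} →
    Unique w → x ∈ w → y ∉ w → restrict x y w ≡ x ∷ []
  restrict-onlyˡ {x} {y} {w} uniq x∈ y∉ = Unique-constant
    (Unique.filter⁺ (either? x y) uniq) (∈-filter⁺ (either? x y) x∈ (inj₁ refl)) const
    where
      const : ∀ {z} → z ∈ restrict x y w → z ≡ x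
      const z∈ with ∈-filter⁻ (either? x y) {xs = w} z∈
      ... | _   , inj₁ z≡x  = z≡x
      ... | z∈w , inj₂ refl = contradiction z∈w y∉

  restrict-onlyʳ : ∀ {x y : Fin k} {w} →
    Unique w → x ∉ w → y ∈ w → restrict x y w ≡ y ∷ []
  restrict-onlyʳ {x} {y} {w} uniq x∉ y∈ =
    trans (restrict-swap-letters x y w) (restrict-onlyˡ uniq y∈ x∉)

-- Enumerations of the colour classes of a 3-coloured graph.

module ThreeColouring
  {k : ℕ} (_~_ : Fin k → Fin k → Set) (~-sym : ∀ {x y} → x ~ y → y ~ x)
  (_~?_ : Decidable _~_)
  (colour : Fin k → Fin 3) (proper : ∀ {x y} → x ~ y → colour x ≢ colour y)
  where

  -- The order of the list is left free: it is what the construction varies from round to round.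
  record Enumerates (c : Fin 3) (w : List (Fin k)) : Set where
    field
      unique   : Unique w
      sound    : ∀ {v} → v ∈ w → colour v ≡ c
      complete : ∀ {v} → colour v ≡ c → v ∈ w

    absent : ∀ {v} → colour v ≢ c → v ∉ w
    absent v≢c = v≢c ∘ sound

  open Enumerates

  Enumerates-resp-↭ : ∀ {c s t} → s ↭ t → Enumerates c s → Enumerates c t
  Enumerates-resp-↭ s↭t e = record
    { unique   = Permutation.Unique-resp-↭ (setoid _) s↭t′ (unique e)
    ; sound    = sound e ∘ ∈-resp-↭ (↭-sym s↭t)
    ; complete = ∈-resp-↭ s↭t ∘ complete e
    }
    where s↭t′ = ↭⇒↭ₛ s↭t

  class : Fin 3 → List (Fin k)
  class c = filter (λ v → colour v Fin.≟ c) (allFin k)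

  class-enumerates : ∀ c → Enumerates c (class c)
  class-enumerates c = record
    { unique   = Unique.filter⁺ _ (Unique.allFin⁺ k)
    ; sound    = λ v∈ → proj₂ (∈-filter⁻ (λ v → colour v Fin.≟ c) {xs = allFin k} v∈)
    ; complete = ∈-filter⁺ _ (∈-allFin _)
    }

  ∈⇒↭ : ∀ {x : Fin k} {w} → x ∈ w → ∃ λ t → w ↭ x ∷ t
  ∈⇒↭ x∈w with ∈-∃++ x∈w
  ... | s , t , refl = s ++ t , shift _ s t

  startingWith : ∀ {c x} → colour x ≡ c → ∃ λ t → Enumerates c (x ∷ t)
  startingWith {c} x≡c with ∈⇒↭ (complete (class-enumerates c) x≡c)
  ... | t , p = t , Enumerates-resp-↭ p (class-enumerates c)

  -- The two enumerations share the tail `t`. Each has its head absent from its own tail, so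
  -- together they show that `t` contains neither letter.
  startingWith₂ : ∀ {c x y} → x ≢ y → colour x ≡ c → colour y ≡ c →
    ∃ λ t → Enumerates c (x ∷ y ∷ t) × Enumerates c (y ∷ x ∷ t)
  startingWith₂ x≢y x≡c y≡c with startingWith x≡c
  ... | s , e with complete e y≡c
  ...   | here y≡x = contradiction (sym y≡x) x≢y
  ...   | there y∈s with ∈⇒↭ y∈s
  ...     | t , p = t , e′ , Enumerates-resp-↭ (swap _ _ refl) e′
    where e′ = Enumerates-resp-↭ (prep _ p) e

  -- Words in which adjacent letters alternate, lower colour first.

  record AlternatesOnEdges (w : List (Fin k)) : Set where
    constructor alternates
    field rounds : ∀ {u v} → u ~ v → colour u Fin.< colour v → Rounds u v (restrict u v w)

  open AlternatesOnEdges

  AlternatesOnEdges-++ : ∀ s {t} →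
    AlternatesOnEdges s → AlternatesOnEdges t → AlternatesOnEdges (s ++ t)
  AlternatesOnEdges-++ s {t} S T = alternates λ {u} {v} u~v u<v →
    subst (Rounds u v) (sym (restrict-++ u v s t))
      (Rounds-++ (rounds S u~v u<v) (rounds T u~v u<v))

  enumeration-onlyˡ : ∀ {c s x y} → Enumerates c s → colour x ≡ c → colour y ≢ c →
    restrict x y s ≡ x ∷ []
  enumeration-onlyˡ e x≡c y≢c = restrict-onlyˡ (unique e) (complete e x≡c) (absent e y≢c)

  enumeration-onlyʳ : ∀ {c s x y} → Enumerates c s → colour x ≢ c → colour y ≡ c →
    restrict x y s ≡ y ∷ []
  enumeration-onlyʳ e x≢c y≡c = restrict-onlyʳ (unique e) (absent e x≢c) (complete e y≡c)

  enumeration-none : ∀ {c s x y} → Enumerates c s → colour x ≢ c → colour y ≢ c →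
    restrict x y s ≡ []
  enumeration-none e x≢c y≢c = restrict-none (absent e x≢c) (absent e y≢c)

  other : ∀ {v} {c d : Fin 3} → colour v ≡ c → c ≢ d → colour v ≢ d
  other refl c≢d = c≢d

  -- Adjacent letters lie in different classes, so a round contains each of them once, the one of
  -- lower colour first. The order inside the classes does not matter.
  round-++ : ∀ {s₀ s₁ s₂ w} →
    Enumerates 0F s₀ → Enumerates 1F s₁ → Enumerates 2F s₂ →
    AlternatesOnEdges w → AlternatesOnEdges (s₀ ++ s₁ ++ s₂ ++ w)
  round-++ {s₀} {s₁} {s₂} {w} e₀ e₁ e₂ W = alternates go
    where
    module _ {u v} (u~v : u ~ v) (u<v : colour u Fin.< colour v) where
      R = Rounds u v
      r₀ = restrict u v s₀
      r₁ = restrict u v s₁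
      r₂ = restrict u v s₂
      r  = restrict u v w
      cases : ∀ c d → colour u ≡ c → colour v ≡ d → R (r₀ ++ r₁ ++ r₂ ++ r)
      cases 0F 1F u₀ v₁
        rewrite enumeration-onlyˡ e₀ u₀ (other v₁ λ ())
              | enumeration-onlyʳ e₁ (other u₀ λ ()) v₁
              | enumeration-none e₂ (other u₀ λ ()) (other v₁ λ ()) = round (rounds W u~v u<v)
      cases 0F 2F u₀ v₂
        rewrite enumeration-onlyˡ e₀ u₀ (other v₂ λ ())
              | enumeration-none e₁ (other u₀ λ ()) (other v₂ λ ())
              | enumeration-onlyʳ e₂ (other u₀ λ ()) v₂ = round (rounds W u~v u<v)
      cases 1F 2F u₁ v₂
        rewrite enumeration-none e₀ (other u₁ λ ()) (other v₂ λ ())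
              | enumeration-onlyˡ e₁ u₁ (other v₂ λ ())
              | enumeration-onlyʳ e₂ (other u₁ λ ()) v₂ = round (rounds W u~v u<v)
      cases 0F 0F u₀ v₀ = contradiction (trans u₀ (sym v₀)) (proper u~v)
      cases 1F 1F u₁ v₁ = contradiction (trans u₁ (sym v₁)) (proper u~v)
      cases 2F 2F u₂ v₂ = contradiction (trans u₂ (sym v₂)) (proper u~v)
      cases 1F 0F u₁ v₀ = contradiction (subst₂ Fin._<_ u₁ v₀ u<v) λ ()
      cases 2F 0F u₂ v₀ = contradiction (subst₂ Fin._<_ u₂ v₀ u<v) λ ()
      cases 2F 1F u₂ v₁ = contradiction (subst₂ Fin._<_ u₂ v₁ u<v) λ { (s≤s ()) }

      go : R (restrict u v (s₀ ++ s₁ ++ s₂ ++ w))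
      go rewrite restrict-++ u v s₀ (s₁ ++ s₂ ++ w) | restrict-++ u v s₁ (s₂ ++ w)
               | restrict-++ u v s₂ w = cases _ _ refl refl

  -- Exchanging non-adjacent neighbours in a word.

  record SameOnEdges (s t : List (Fin k)) : Set where
    constructor same
    field agree : ∀ {u v} → u ~ v → restrict u v s ≡ restrict u v t

  open SameOnEdges

  SameOnEdges-++ : ∀ w {s t} → SameOnEdges s t → SameOnEdges (w ++ s) (w ++ t)
  SameOnEdges-++ w {s} {t} S = same λ {u} {v} u~v → begin
    restrict u v (w ++ s)               ≡⟨ restrict-++ u v w s ⟩
    restrict u v w ++ restrict u v s    ≡⟨ cong (restrict u v w ++_) (agree S u~v) ⟩
    restrict u v w ++ restrict u v t    ≡⟨ restrict-++ u v w t ⟨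
    restrict u v (w ++ t)               ∎
    where open ≡-Reasoning

  -- Only a restriction that keeps both `x` and `y` can notice the exchange, and the ends of an edge
  -- are never this pair.
  exchange : ∀ {x y} s w → x ≢ y → ¬ x ~ y →
    SameOnEdges ((s ∷ʳ x) ++ y ∷ w) (s ++ y ∷ x ∷ w)
  exchange {x} {y} s w x≢y x≁y rewrite ∷ʳ-++ s x (y ∷ w) =
    SameOnEdges-++ s (same λ {u} {v} u~v → filter-swap (either? u v) {x} {y} w λ where
      (inj₁ refl , inj₁ refl) → x≢y refl
      (inj₁ refl , inj₂ refl) → x≁y u~v
      (inj₂ refl , inj₁ refl) → x≁y (~-sym u~v)
      (inj₂ refl , inj₂ refl) → x≢y refl)

  AlternatesOnEdges-resp : ∀ {s t} →
    SameOnEdges s t → AlternatesOnEdges s → AlternatesOnEdges t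
  AlternatesOnEdges-resp S W = alternates λ u~v u<v →
    subst (Rounds _ _) (agree S u~v) (rounds W u~v u<v)

  -- Certificates that a pair does not alternate.

  record Clash (x y : Fin k) (w : List (Fin k)) : Set where
    constructor clash
    field stutters : Stutters (restrict x y w)

  -- Two occurrences of `y` with no `x` between them. Two intermediate blocks suffice, since
  -- recurrences of `y` are compared only across one turn of the three classes.
  Clash-intro : ∀ {x y} s s′ s″ w → restrict x y s ≡ y ∷ [] →
    restrict x y s′ ≡ [] → restrict x y s″ ≡ [] →
    Clash x y (s ++ s′ ++ s″ ++ y ∷ w)
  Clash-intro {x} {y} s s′ s″ w eq eq′ eq″ = clash go
    where
      go : Stutters (restrict x y (s ++ s′ ++ s″ ++ y ∷ w))
      go rewrite restrict-++ x y s (s′ ++ s″ ++ y ∷ w)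
               | restrict-++ x y s′ (s″ ++ y ∷ w)
               | restrict-++ x y s″ (y ∷ w)
               | eq | eq′ | eq″ | restrict-∷ʳ x y w = here

  Clash-++ˡ : ∀ {x y} s {t} → Clash x y t → Clash x y (s ++ t)
  Clash-++ˡ {x} {y} s {t} (clash σ) = clash
    (subst Stutters (sym (restrict-++ x y s t)) (Stutters-++ˡ _ σ))

  Clash-++ʳ : ∀ {x y s} t → Clash x y s → Clash x y (s ++ t)
  Clash-++ʳ {x} {y} {s} t (clash σ) = clash
    (subst Stutters (sym (restrict-++ x y s t)) (Stutters-++ʳ _ σ))

  Clash-sym : ∀ {x y w} → Clash x y w → Clash y x w
  Clash-sym {x} {y} {w} (clash σ) = clash (subst Stutters (restrict-swap-letters x y w) σ)

  -- A word separating one non-adjacent pair.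

  Separator : Fin k → Fin k → List (Fin k) → Set
  Separator x y w = AlternatesOnEdges w × Clash x y w

  []-alternates : AlternatesOnEdges []
  []-alternates = alternates λ _ _ → []

  private
    V₀ V₁ V₂ : List (Fin k)
    V₀ = class 0F
    V₁ = class 1F
    V₂ = class 2F
    e₀ = class-enumerates 0F
    e₁ = class-enumerates 1F
    e₂ = class-enumerates 2F

  head-absent : ∀ {c x s} → Enumerates c (x ∷ s) → x ∉ s
  head-absent e x∈s with unique e
  ... | x≢ ∷ _ = All.lookup x≢ x∈s refl

  -- Two rounds that differ only in the order of `x` and `y` restrict to `x y y x`.
  separator-same : ∀ {x y} c → x ≢ y → colour x ≡ c → colour y ≡ c → ∃ (Separator x y)
  separator-same {x} {y} c x≢y xc yc with startingWith₂ x≢y xc yc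
  ... | t , exy , eyx = separator c xc yc exy eyx
    where
      -- The leading `x` is split off below, so that what remains of the first copy of the class
      -- contributes the first half of the stutter `y y`.
      skip : restrict x y (y ∷ t) ≡ y ∷ []
      skip = trans (restrict-∷ʳ x y t) (cong (y ∷_)
        (restrict-none (head-absent exy ∘ there) (head-absent eyx ∘ there)))
      separator : ∀ c → colour x ≡ c → colour y ≡ c →
        Enumerates c (x ∷ y ∷ t) → Enumerates c (y ∷ x ∷ t) → ∃ (Separator x y)
      separator 0F xc yc exy eyx = _ ,
        round-++ exy e₁ e₂ (round-++ eyx e₁ e₂ []-alternates) ,
        Clash-++ˡ (x ∷ []) (Clash-intro (y ∷ t) V₁ V₂ _ skip
          (enumeration-none e₁ (other xc λ ()) (other yc λ ()))
          (enumeration-none e₂ (other xc λ ()) (other yc λ ())))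
      separator 1F xc yc exy eyx = _ ,
        round-++ e₀ exy e₂ (round-++ e₀ eyx e₂ []-alternates) ,
        Clash-++ˡ V₀ (Clash-++ˡ (x ∷ [])
          (Clash-intro (y ∷ t) V₂ V₀ _ skip
            (enumeration-none e₂ (other xc λ ()) (other yc λ ()))
            (enumeration-none e₀ (other xc λ ()) (other yc λ ()))))
      separator 2F xc yc exy eyx = _ ,
        round-++ e₀ e₁ exy (round-++ e₀ e₁ eyx []-alternates) ,
        Clash-++ˡ V₀ (Clash-++ˡ V₁ (Clash-++ˡ (x ∷ [])
          (Clash-intro (y ∷ t) V₀ V₁ _ skip
            (enumeration-none e₀ (other xc λ ()) (other yc λ ()))
            (enumeration-none e₁ (other xc λ ()) (other yc λ ())))))

  next : Fin 3 → Fin 3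
  next 0F = 1F
  next 1F = 2F
  next 2F = 0F

  -- An earlier occurrence of `y` is followed by the exchanged pair `y x`. Before the exchange the
  -- word is made of rounds, and the exchange is invisible to edges.
  separator-next : ∀ {x y} c → x ≢ y → ¬ x ~ y →
    colour x ≡ c → colour y ≡ next c → ∃ (Separator x y)
  separator-next {x} {y} c x≢y x≁y xc yc with startingWith xc | startingWith yc
  ... | s , ex | t , ey =
    -- The permuted enumeration puts `x` last, next to `y`. The original one is kept to show that
    -- `s` contains neither letter.
    separator c xc yc ex ey (Enumerates-resp-↭ (∷↭∷ʳ x s) ex)
    where
      skip : ∀ {c} → colour y ≢ c → Enumerates c (x ∷ s) → restrict x y s ≡ []
      skip y≢c ex = restrict-none (head-absent ex) (absent ex y≢c ∘ there)
      separator : ∀ c → colour x ≡ c → colour y ≡ next c →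
        Enumerates c (x ∷ s) → Enumerates (next c) (y ∷ t) → Enumerates c (s ∷ʳ x) →
        ∃ (Separator x y)
      separator 0F x₀ y₁ ex ey ex′ = _ ,
        AlternatesOnEdges-resp
          (SameOnEdges-++ V₀ (SameOnEdges-++ V₁ (SameOnEdges-++ V₂
            (exchange s (t ++ V₂ ++ []) x≢y x≁y))))
          (round-++ e₀ e₁ e₂ (round-++ ex′ ey e₂ []-alternates)) ,
        Clash-++ˡ V₀ (Clash-intro V₁ V₂ s _
          (enumeration-onlyʳ e₁ (other x₀ λ ()) y₁)
          (enumeration-none e₂ (other x₀ λ ()) (other y₁ λ ()))
          (skip (other y₁ λ ()) ex))
      separator 1F x₁ y₂ ex ey ex′ = _ ,
        AlternatesOnEdges-resp
          (SameOnEdges-++ V₀ (SameOnEdges-++ V₁ (SameOnEdges-++ V₂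
            (SameOnEdges-++ V₀ (exchange s (t ++ []) x≢y x≁y)))))
          (round-++ e₀ e₁ e₂ (round-++ e₀ ex′ ey []-alternates)) ,
        Clash-++ˡ V₀ (Clash-++ˡ V₁ (Clash-intro V₂ V₀ s _
          (enumeration-onlyʳ e₂ (other x₁ λ ()) y₂)
          (enumeration-none e₀ (other x₁ λ ()) (other y₂ λ ()))
          (skip (other y₂ λ ()) ex)))
      -- Here the exchange crosses the border between the two rounds, and the earlier `y` lies in
      -- the class opening the first. The restriction is `y y x x`.
      separator 2F x₂ y₀ ex ey ex′ = _ ,
        AlternatesOnEdges-resp
          (SameOnEdges-++ V₀ (SameOnEdges-++ V₁
            (exchange s (t ++ V₁ ++ V₂ ++ []) x≢y x≁y)))
          (round-++ e₀ e₁ ex′ (round-++ ey e₁ e₂ []-alternates)) ,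
        Clash-intro V₀ V₁ s _
          (enumeration-onlyʳ e₀ (other x₂ λ ()) y₀)
          (enumeration-none e₁ (other x₂ λ ()) (other y₀ λ ()))
          (skip (other y₀ λ ()) ex)

  separator : ∀ {x y} → x ≢ y → ¬ x ~ y → ∃ (Separator x y)
  separator {x} {y} x≢y x≁y = cases _ _ refl refl
    where
      forwards : ∀ c → colour x ≡ c → colour y ≡ next c → ∃ (Separator x y)
      forwards c = separator-next c x≢y x≁y
      backwards : ∀ c → colour x ≡ next c → colour y ≡ c → ∃ (Separator x y)
      backwards c xc yc with separator-next c (x≢y ∘ sym) (x≁y ∘ ~-sym) yc xc
      ... | w , A , χ = w , A , Clash-sym χ
      cases : ∀ c d → colour x ≡ c → colour y ≡ d → ∃ (Separator x y)
      cases 0F 0F = separator-same 0F x≢y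
      cases 1F 1F = separator-same 1F x≢y
      cases 2F 2F = separator-same 2F x≢y
      cases 0F 1F = forwards 0F
      cases 1F 2F = forwards 1F
      cases 2F 0F = forwards 2F
      cases 1F 0F = backwards 0F
      cases 2F 1F = backwards 1F
      cases 0F 2F = backwards 2F

  -- One word for all pairs.

  separators : ∀ ps → ∃ λ w → AlternatesOnEdges w ×
    (∀ {x y} → (x , y) ∈ ps → x ≢ y → ¬ x ~ y → Clash x y w)
  separators [] = [] , []-alternates , λ ()
  separators ((x , y) ∷ ps) with separators ps | x Fin.≟ y | x ~? y
  ... | w , W , σ | yes x≡y | _ = w , W , λ where
    (here refl) x≢y → contradiction x≡y x≢y
    (there p)       → σ p
  ... | w , W , σ | no _ | yes x~y = w , W , λ where
    (here refl) _ x≁y → contradiction x~y x≁y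
    (there p)         → σ p
  -- Only distinct non-adjacent pairs call for a new block; clashes already obtained survive its
  -- being put in front.
  ... | w , W , σ | no x≢y | no x≁y with separator x≢y x≁y
  ...   | s , S , σ′ = s ++ w , AlternatesOnEdges-++ s S W , λ where
    (here refl) _ _ → Clash-++ʳ w σ′
    (there p) x≢y x≁y → Clash-++ˡ s (σ p x≢y x≁y)

  represent : ∃ λ w → (∀ v → v ∈ w) ×
    (∀ x y → x ≢ y → (x ~ y ⇔ Alternate x y w))
  represent with separators (cartesianProduct (allFin k) (allFin k))
  ... | s , S , χ = word , (λ v → everywhere v _ refl) , λ x y x≢y →
      mk⇔ alternate (adjacent x≢y)
    where
      word : List (Fin k)
      -- The extra round guarantees that every letter occurs, even when no pair had to be separated
      -- and `s` is empty.
      word = V₀ ++ V₁ ++ V₂ ++ s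
      everywhere : ∀ v c → colour v ≡ c → v ∈ word
      everywhere v 0F eq = ∈-++⁺ˡ (complete e₀ eq)
      everywhere v 1F eq = ∈-++⁺ʳ V₀ (∈-++⁺ˡ (complete e₁ eq))
      everywhere v 2F eq = ∈-++⁺ʳ V₀ (∈-++⁺ʳ V₁ (∈-++⁺ˡ (complete e₂ eq)))
      word-alternates : AlternatesOnEdges word
      word-alternates = round-++ e₀ e₁ e₂ S
      alternate : ∀ {x y} → x ~ y → Alternate x y word
      alternate {x} {y} x~y with Fin.<-cmp (colour x) (colour y)
      ... | tri< x<y _ _ = inj₁ (Rounds⇒AlternatingFrom (rounds word-alternates x~y x<y))
      ... | tri≈ _ x≡y _ = contradiction x≡y (proper x~y)
      ... | tri> _ _ y<x = inj₂ (subst (AlternatingFrom y x)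
        (restrict-swap-letters y x word)
        (Rounds⇒AlternatingFrom (rounds word-alternates (~-sym x~y) y<x)))
      adjacent : ∀ {x y} → x ≢ y → Alternate x y word → x ~ y
      adjacent {x} {y} x≢y α with x ~? y
      ... | yes x~y = x~y
      -- The stutter rules out both possible first letters.
      ... | no x≁y = contradiction α
        [ Stutters⇒¬AlternatingFrom x≢y σ , Stutters⇒¬AlternatingFrom (x≢y ∘ sym) σ ]′
        where
          σ : Stutters (restrict x y word)
          σ = Clash.stutters (Clash-++ˡ V₀ (Clash-++ˡ V₁ (Clash-++ˡ V₂
            (χ (∈-cartesianProduct⁺ (∈-allFin x) (∈-allFin y)) x≢y x≁y))))

threeColourable⇒wordRepresentable : (G : Graph) → let open Graph G in
  Decidable _~_ → (colour : Fin order → Fin 3) →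
  (∀ {x y} → x ~ y → colour x ≢ colour y) → WordRepresentable G
threeColourable⇒wordRepresentable G _~?_ colour proper =
  ThreeColouring.represent _~_ ~-sym _~?_ colour proper
  where open Graph G

-- Congruences and circular distance.

infix 4 _≡_[mod_]

-- Integers rather than naturals, because the multiplier that a generator provides may be negative.
_≡_[mod_] : ℤ → ℤ → ℕ → Set
x ≡ y [mod m ] = + m ∣ x ℤ.- y

%-congruent : ∀ m .{{_ : NonZero m}} x → + (x ℤ.%ℕ m) ≡ x [mod m ]
%-congruent m x = divides (ℤ.- q) (begin
  r ℤ.- x                    ≡⟨ cong (λ z → r ℤ.- z) (ℤ.a≡a%ℕn+[a/ℕn]*n x m) ⟩
  r ℤ.- (r ℤ.+ q ℤ.* + m)    ≡⟨ identity r q (+ m) ⟩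
  ℤ.- q ℤ.* + m              ∎)
  where
    open ≡-Reasoning
    r = + (x ℤ.%ℕ m)
    q = x ℤ./ℕ m
    identity : ∀ r q m → r ℤ.- (r ℤ.+ q ℤ.* m) ≡ ℤ.- q ℤ.* m
    identity = ℤ-Solver.solve-∀

-- This is what limits the colours to three: a residue below `m` has quotient below 3 on division by
-- `⌈ m / 3 ⌉`.
m≤⌈m/3⌉*3 : ∀ m → m ≤ 3 * ⌈ m / 3 ⌉
m≤⌈m/3⌉*3 m = +-cancelʳ-≤ 2 m _ (begin
  m + 2                                  ≡⟨ m≡m%n+[m/n]*n (m + 2) 3 ⟩
  (m + 2) % 3 + (m + 2) / 3 * 3          ≤⟨ +-monoˡ-≤ _ (s≤s⁻¹ (m%n<n (m + 2) 3)) ⟩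
  2 + (m + 2) / 3 * 3                    ≡⟨ +-comm 2 _ ⟩
  (m + 2) / 3 * 3 + 2                    ≡⟨ cong (λ z → z + 2) (*-comm ((m + 2) / 3) 3) ⟩
  3 * ⌈ m / 3 ⌉ + 2                      ∎)
  where open ≤-Reasoning

-- With `D` the absolute difference, the larger vertex is the smaller plus `D`, and going round the
-- other way the smaller is the larger plus `m ∸ D`. The minimum selects one of the two.
circularDistance⇒congruent : ∀ m (i j : Fin m) {d} → circularDistance m i j ≡ d →
  (+ toℕ i ≡ + toℕ j ℤ.+ + d [mod m ]) ⊎ (+ toℕ j ≡ + toℕ i ℤ.+ + d [mod m ])
circularDistance⇒congruent m i j refl =
  cases (≤-total (toℕ j) (toℕ i)) (⊓-sel D (m ∸ D))
  where
    D = ∣ toℕ i - toℕ j ∣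
    D≤m : D ≤ m
    D≤m = ≤-trans (∣m-n∣≤m⊔n (toℕ i) (toℕ j)) (⊔-lub (Fin.toℕ≤n i) (Fin.toℕ≤n j))

    ordered : ∀ {x y} → x ≤ y → D ≡ ∣ x - y ∣ → y ≡ x + D
    ordered {x} x≤y eq = sym (trans (cong (λ z → x + z) (trans eq (m≤n⇒∣m-n∣≡n∸m x≤y))) (m+[n∸m]≡n x≤y))

    near : ∀ {x y e} → x ≡ y + e → + x ≡ + y ℤ.+ + e [mod m ]
    near {y = y} {e} refl = divides (+ 0) (ℤ.+-inverseʳ (+ (y + e)))

    far : ∀ {x y} → x ≡ y + D → + y ≡ + x ℤ.+ + (m ∸ D) [mod m ]
    far {y = y} refl = divides (ℤ.- + 1) (begin
      + y ℤ.- (+ y ℤ.+ + D ℤ.+ + (m ∸ D))    ≡⟨ identity (+ y) (+ D) (+ (m ∸ D)) ⟩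
      ℤ.- + 1 ℤ.* (+ D ℤ.+ + (m ∸ D))        ≡⟨ cong (λ z → ℤ.- + 1 ℤ.* + z) (m+[n∸m]≡n D≤m) ⟩
      ℤ.- + 1 ℤ.* + m                        ∎)
      where
        open ≡-Reasoning
        identity : ∀ y d e → y ℤ.- (y ℤ.+ d ℤ.+ e) ≡ ℤ.- + 1 ℤ.* (d ℤ.+ e)
        identity = ℤ-Solver.solve-∀

    cases : toℕ j ≤ toℕ i ⊎ toℕ i ≤ toℕ j → (D ⊓ (m ∸ D) ≡ D) ⊎ (D ⊓ (m ∸ D) ≡ m ∸ D) →
      (+ toℕ i ≡ + toℕ j ℤ.+ + (D ⊓ (m ∸ D)) [mod m ]) ⊎
      (+ toℕ j ≡ + toℕ i ℤ.+ + (D ⊓ (m ∸ D)) [mod m ])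
    cases (inj₁ j≤i) (inj₁ eq) rewrite eq = inj₁ (near {y = toℕ j} (ordered j≤i (∣-∣-comm _ (toℕ j))))
    cases (inj₁ j≤i) (inj₂ eq) rewrite eq = inj₂ (far (ordered j≤i (∣-∣-comm _ (toℕ j))))
    cases (inj₂ i≤j) (inj₁ eq) rewrite eq = inj₂ (near {y = toℕ i} (ordered i≤j refl))
    cases (inj₂ i≤j) (inj₂ eq) rewrite eq = inj₁ (far (ordered i≤j refl))

-- Multiples in the cyclic group and the inverse of a generator.

module _ (n : ℕ) .{{_ : NonZero n}} where
  open ℤ₂ₙ n

  private instance
    2n≢0 : NonZero (2 * n)
    2n≢0 = m*n≢0 2 n

  toℕ-mod : ∀ x → + toℕ (x mod (2 * n)) ≡ + x [mod 2 * n ]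
  toℕ-mod x rewrite Fin.toℕ-fromℕ< (m%n<n x (2 * n)) = %-congruent (2 * n) (+ x)

  ⁺·-congruent : ∀ k g → + toℕ ((+ k) · g) ≡ + k ℤ.* + toℕ g [mod 2 * n ]
  ⁺·-congruent zero g = toℕ-mod 0
  ⁺·-congruent (suc k) g = subst (+ (2 * n) ∣_)
    (identity (+ toℕ ((+ suc k) · g)) (+ toℕ ((+ k) · g)) (+ toℕ g) (+ k))
    (∣m∣n⇒∣m+n (toℕ-mod (toℕ g + toℕ ((+ k) · g))) (⁺·-congruent k g))
    where
      identity : ∀ s t g k → (s ℤ.- (g ℤ.+ t)) ℤ.+ (t ℤ.- k ℤ.* g) ≡ s ℤ.- (+ 1 ℤ.+ k) ℤ.* g
      identity = ℤ-Solver.solve-∀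

  ·-congruent : ∀ k g → + toℕ (k · g) ≡ k ℤ.* + toℕ g [mod 2 * n ]
  ·-congruent (+ k) g = ⁺·-congruent k g
  -- The group inverse of `h` is represented by `2 * n ∸ toℕ h`, which cancels `toℕ h` modulo
  -- `2 * n`; this reduces the claim to the positive multiple.
  ·-congruent -[1+ k ] g = subst (+ (2 * n) ∣_) identity
    (∣m∣n⇒∣m-n (∣m∣n⇒∣m+n (toℕ-mod (2 * n ∸ toℕ h)) (divides (+ 1) complement))
      (⁺·-congruent (suc k) g))
    where
      h = (+ suc k) · g
      complement : + (2 * n ∸ toℕ h) ℤ.+ + toℕ h ≡ + 1 ℤ.* + (2 * n)
      complement = trans (cong +_ (m∸n+n≡m (Fin.toℕ≤n h))) (sym (ℤ.*-identityˡ _))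
      identity : _ ≡ + toℕ (-[1+ k ] · g) ℤ.- -[1+ k ] ℤ.* + toℕ g
      identity = ring (+ toℕ (-[1+ k ] · g)) (+ (2 * n ∸ toℕ h)) (+ toℕ h) (+ suc k) (+ toℕ g)
        where
          ring : ∀ s c h k g →
            (s ℤ.- c) ℤ.+ (c ℤ.+ h) ℤ.- (h ℤ.- k ℤ.* g) ≡ s ℤ.- (ℤ.- k) ℤ.* g
          ring = ℤ-Solver.solve-∀

  -- A generator has 1 among its multiples, and the multiplier is then its multiplicative inverse.
  unit : ∀ {g} → IsGenerator g → ∃ λ u → u ℤ.* + toℕ g ≡ + 1 [mod 2 * n ]
  unit {g} gen with gen (1 mod (2 * n))
  ... | u , eq = u , subst (+ (2 * n) ∣_) (identity (u ℤ.* + toℕ g) (+ toℕ (u · g)))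
    (∣m∣n⇒∣m-n (subst (λ h → + toℕ h ≡ + 1 [mod 2 * n ]) (sym eq) (toℕ-mod 1))
      (·-congruent u g))
    where
      identity : ∀ x y → (y ℤ.- + 1) ℤ.- (y ℤ.- x) ≡ x ℤ.- + 1
      identity = ℤ-Solver.solve-∀

-- Distances between coordinates, and the jump n.

separated : ∀ {m t P x y} → t ≤ P → P + t ≤ m → + x ≡ + y ℤ.+ + P [mod m ] →
  t ≤ ∣ x - y ∣
separated {m} {t} {P} {x} {y} t≤P P+t≤m (divides q eq) = cases q eq
  where
    arrange : ∀ {q} → + x ℤ.- (+ y ℤ.+ + P) ≡ q → + x ≡ + y ℤ.+ + P ℤ.+ q
    arrange {q} refl = ring (+ x) (+ y) (+ P)
      where
        ring : ∀ x y p → x ≡ y ℤ.+ p ℤ.+ (x ℤ.- (y ℤ.+ p))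
        ring = ℤ-Solver.solve-∀
    cases : ∀ q → + x ℤ.- (+ y ℤ.+ + P) ≡ q ℤ.* + m → t ≤ ∣ x - y ∣
    -- No backward wrap: `x` exceeds `y` by at least `P`, hence by at least `t`.
    cases (+ q) eq = begin
      t                         ≤⟨ t≤P ⟩
      P                         ≤⟨ m≤m+n P (q * m) ⟩
      P + q * m                 ≡⟨ ∣m-m+n∣≡n y (P + q * m) ⟨
      ∣ y - y + (P + q * m) ∣   ≡⟨ cong (λ z → ∣ y - z ∣) x≡ ⟨
      ∣ y - x ∣                 ≡⟨ ∣-∣-comm y x ⟩
      ∣ x - y ∣                 ∎
      where
        open ≤-Reasoning
        x≡ : x ≡ y + (P + q * m)
        x≡ = trans (ℤ.+-injective (trans (arrange eq)
          (cong (ℤ._+_ (+ (y + P))) (sym (ℤ.pos-* q m))))) (+-assoc y P _)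
    -- At least one backward wrap: `y` exceeds `x` by at least `m` minus `P`, hence by at least `t`.
    cases -[1+ q ] eq = +-cancelˡ-≤ P _ _ (begin
      P + t                 ≤⟨ P+t≤m ⟩
      m                     ≤⟨ m≤m+n m (q * m) ⟩
      suc q * m             ≤⟨ +-cancelˡ-≤ x _ _ (begin
        x + suc q * m         ≡⟨ x+ ⟩
        y + P                 ≤⟨ +-monoˡ-≤ P (m≤n+∣n-m∣ y x) ⟩
        x + ∣ x - y ∣ + P     ≡⟨ +-assoc x _ P ⟩
        x + (∣ x - y ∣ + P)   ∎) ⟩
      ∣ x - y ∣ + P         ≡⟨ +-comm _ P ⟩
      P + ∣ x - y ∣         ∎)
      where
        open ≤-Reasoning
        x+ : x + suc q * m ≡ y + P
        x+ = ℤ.+-injective (trans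
          (cong₂ ℤ._+_ (arrange eq) (ℤ.pos-* (suc q) m))
          (ring (+ (y + P)) (+ suc q) (+ m)))
          where
            ring : ∀ z q m → z ℤ.+ (ℤ.- q) ℤ.* m ℤ.+ q ℤ.* m ≡ z
            ring = ℤ-Solver.solve-∀

same-quotient⇒∣-∣< : ∀ t .{{_ : NonZero t}} {x y} → x / t ≡ y / t → ∣ x - y ∣ < t
same-quotient⇒∣-∣< t {x} {y} eq = begin-strict
  ∣ x - y ∣                                       ≡⟨ cong₂ ∣_-_∣ (m≡m%n+[m/n]*n x t) (m≡m%n+[m/n]*n y t) ⟩
  ∣ x % t + x / t * t - y % t + y / t * t ∣       ≡⟨ cong (λ q → ∣ x % t + q * t - y % t + y / t * t ∣) eq ⟩
  ∣ x % t + y / t * t - y % t + y / t * t ∣       ≡⟨ cong₂ ∣_-_∣ (+-comm (x % t) _) (+-comm (y % t) _) ⟩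
  ∣ y / t * t + x % t - y / t * t + y % t ∣       ≡⟨ ∣m+n-m+o∣≡∣n-o∣ (y / t * t) _ _ ⟩
  ∣ x % t - y % t ∣                               ≤⟨ ∣m-n∣≤m⊔n (x % t) (y % t) ⟩
  x % t ⊔ y % t                                   <⟨ ⊔-pres-<m (m%n<n x t) (m%n<n y t) ⟩
  t                                               ∎
  where open ≤-Reasoning

-- A unit modulo an even number is odd, and for `u = 1 + 2q` the product with `n` is `n` plus `q`
-- times `2 * n`.
unit-fixes-half : ∀ n .{{_ : NonZero n}} {u h} →
  u ℤ.* h ≡ + 1 [mod 2 * n ] → u ℤ.* + n ≡ + n [mod 2 * n ]
unit-fixes-half n {u} {h} (divides e uh≡1)
  with u ℤ.%ℕ 2 | u ℤ./ℕ 2 | ℤ.n%ℕd<d u 2 | ℤ.a≡a%ℕn+[a/ℕn]*n u 2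
-- If `u` were even, then 1, differing from `u` times `h` by a multiple of `2 * n`, would be even
-- too.
... | 0 | q | _ | refl = contradiction (∣1⇒≡1 (∣⇒∣ᵤ even)) λ ()
  where
    even : + 2 ∣ + 1
    even = divides (q ℤ.* h ℤ.- e ℤ.* + n) (begin
      + 1                                                      ≡⟨ ring₁ ((+ 0 ℤ.+ q ℤ.* + 2) ℤ.* h) ⟩
      (+ 0 ℤ.+ q ℤ.* + 2) ℤ.* h ℤ.- ((+ 0 ℤ.+ q ℤ.* + 2) ℤ.* h ℤ.- + 1)
                                                               ≡⟨ cong (λ z → (+ 0 ℤ.+ q ℤ.* + 2) ℤ.* h ℤ.- z)
                                                                    (trans uh≡1 (cong (e ℤ.*_) (ℤ.pos-* 2 n))) ⟩
      (+ 0 ℤ.+ q ℤ.* + 2) ℤ.* h ℤ.- e ℤ.* (+ 2 ℤ.* + n)        ≡⟨ ring₂ q h e (+ n) ⟩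
      (q ℤ.* h ℤ.- e ℤ.* + n) ℤ.* + 2                          ∎)
      where
        open ≡-Reasoning
        ring₁ : ∀ x → + 1 ≡ x ℤ.- (x ℤ.- + 1)
        ring₁ = ℤ-Solver.solve-∀
        ring₂ : ∀ q h e n → (+ 0 ℤ.+ q ℤ.* + 2) ℤ.* h ℤ.- e ℤ.* (+ 2 ℤ.* n) ≡
          (q ℤ.* h ℤ.- e ℤ.* n) ℤ.* + 2
        ring₂ = ℤ-Solver.solve-∀
... | 1 | q | _ | refl = divides q (trans (ring q (+ n)) (cong (q ℤ.*_) (sym (ℤ.pos-* 2 n))))
  where
    ring : ∀ q n → (+ 1 ℤ.+ q ℤ.* + 2) ℤ.* n ℤ.- n ≡ q ℤ.* (+ 2 ℤ.* n)
    ring = ℤ-Solver.solve-∀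
... | suc (suc _) | _ | s≤s (s≤s ()) | _

-- Colouring the circulant graph by arcs.

theorem19 : (n : ℕ) .{{_ : NonZero n}} (a b : ℕ) → a ≢ b →
    (0<a : 0 < a) (a<n : a < n) (0<b : 0 < b) (b<n : b < n) →
    let open ℤ₂ₙ n in
    (∃ λ (g : Carrier) → IsGenerator g ×
    (∃₂ λ (p q : ℕ) →
    p < 2 * n × q < 2 * n ×
    toℕ ((+ p) · g) ≡ a × toℕ ((+ q) · g) ≡ b ×
    p ⊓ q ⊓ (2 * n ∸ p) ⊓ (2 * n ∸ q) ≥ ⌈ 2 * n / 3 ⌉)) →
    WordRepresentable (C₂ₙ n a b 0<a a<n 0<b b<n)
theorem19 n a b _ 0<a a<n 0<b b<n (g , gen , p , q , p<m , q<m , pg≡a , qg≡b , r≥t) =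
  threeColourable⇒wordRepresentable (C₂ₙ n a b 0<a a<n 0<b b<n)
    (λ i j → let d = circularDistance m i j in
      (a ≟ d) ⊎-dec ((b ≟ d) ⊎-dec (n ≟ d)))
    colour proper
  where
    m = 2 * n
    t = ⌈ m / 3 ⌉
    instance
      m≢0 : NonZero m
      m≢0 = m*n≢0 2 n
      t≢0 : NonZero t
      t≢0 = m*n≢0⇒n≢0 3 {{>-nonZero (<-≤-trans (>-nonZero⁻¹ m) (m≤⌈m/3⌉*3 m))}}

    u = proj₁ (unit n gen)
    ug≡1 = proj₂ (unit n gen)

    -- The integer x with 0 ≤ x < m and x · g = v.
    coordinate : Fin m → ℕ
    coordinate v = (u ℤ.* + toℕ v) ℤ.%ℕ m

    -- The value is `coordinate v / t`, the index of the arc of length `t` containing the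
    -- coordinate; the bound passed to `fromℕ<` determines it.
    colour : Fin m → Fin 3
    colour v = fromℕ< (m<n*o⇒m/o<n
      (<-≤-trans (ℤ.n%ℕd<d (u ℤ.* + toℕ v) m) (m≤⌈m/3⌉*3 m)))

    -- In coordinates, a jump by `d` is a step by `size`. The two inequalities say that this step
    -- has length at least `t` both ways round the circle.
    record Jump (d : ℕ) : Set where
      field
        size      : ℕ
        congruent : u ℤ.* + d ≡ + size [mod m ]
        t≤size    : t ≤ size
        size+t≤m  : size + t ≤ m

    -- Multiplying `d ≡ p g` by the inverse `u` of `g` leaves `p` as the step.
    multiple : ∀ {p d} → p < m → toℕ (ℤ₂ₙ._·_ n (+ p) g) ≡ d → t ≤ p → t ≤ m ∸ p → Jump d
    multiple {p} {d} p<m refl t≤p t≤m∸p = record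
      { size      = p
      ; congruent = subst (+ m ∣_) (ring u (+ d) (+ p) (+ toℕ g))
          (∣m∣n⇒∣m+n (∣n⇒∣m*n u (·-congruent n (+ p) g)) (∣n⇒∣m*n (+ p) ug≡1))
      ; t≤size    = t≤p
      ; size+t≤m  = subst (_≤ m) (+-comm t p) (m≤o∸n⇒m+n≤o t (<⇒≤ p<m) t≤m∸p)
      }
      where
        ring : ∀ u d p g →
          u ℤ.* (d ℤ.- p ℤ.* g) ℤ.+ p ℤ.* (u ℤ.* g ℤ.- + 1) ≡ u ℤ.* d ℤ.- p
        ring = ℤ-Solver.solve-∀

    t≤p⊓q⊓[m∸p] : t ≤ p ⊓ q ⊓ (m ∸ p)
    t≤p⊓q⊓[m∸p] = m≤n⊓o⇒m≤n _ (m ∸ q) r≥t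

    t≤p⊓q : t ≤ p ⊓ q
    t≤p⊓q = m≤n⊓o⇒m≤n (p ⊓ q) (m ∸ p) t≤p⊓q⊓[m∸p]

    jump-a : Jump a
    jump-a = multiple p<m pg≡a (m≤n⊓o⇒m≤n p q t≤p⊓q) (m≤n⊓o⇒m≤o (p ⊓ q) _ t≤p⊓q⊓[m∸p])

    jump-b : Jump b
    jump-b = multiple q<m qg≡b (m≤n⊓o⇒m≤o p q t≤p⊓q) (m≤n⊓o⇒m≤o (p ⊓ q ⊓ (m ∸ p)) _ r≥t)

    jump-n : Jump n
    jump-n = record
      { size      = n
      ; congruent = unit-fixes-half n {u} {+ toℕ g} ug≡1
      ; t≤size    = t≤n
      ; size+t≤m  = +-monoʳ-≤ n (≤-trans t≤n (m≤m+n n 0))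
      }
      where
        t≤n : t ≤ n
        -- The bounds for the jump `a` give `2t ≤ p + t ≤ 2n`.
        t≤n = *-cancelˡ-≤ 2 (≤-trans
          (+-mono-≤ (Jump.t≤size jump-a) (≤-reflexive (+-identityʳ t))) (Jump.size+t≤m jump-a))

    -- Multiplication by `u` turns the congruence between vertices into one between coordinates,
    -- with `size` in place of `d`.
    apart : ∀ {i j d} → Jump d → + toℕ i ≡ + toℕ j ℤ.+ + d [mod m ] →
      t ≤ ∣ coordinate i - coordinate j ∣
    apart {i} {j} {d} jump i≡j+d = separated {y = coordinate j} t≤size size+t≤m (subst (+ m ∣_)
      (ring u (+ toℕ i) (+ toℕ j) (+ d) (+ size) (+ coordinate i) (+ coordinate j))
      (∣m∣n⇒∣m+n (∣m∣n⇒∣m-n (%-congruent m (u ℤ.* + toℕ i)) (%-congruent m (u ℤ.* + toℕ j)))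
        (∣m∣n⇒∣m+n (∣n⇒∣m*n u i≡j+d) congruent)))
      where
        open Jump jump
        ring : ∀ u i j d s x y →
          (x ℤ.- u ℤ.* i) ℤ.- (y ℤ.- u ℤ.* j) ℤ.+ (u ℤ.* (i ℤ.- (j ℤ.+ d)) ℤ.+ (u ℤ.* d ℤ.- s))
          ≡ x ℤ.- (y ℤ.+ s)
        ring = ℤ-Solver.solve-∀

    -- Equal colours put both coordinates in one arc, at distance less than `t`, whereas the jump
    -- keeps them at least `t` apart.
    differ : ∀ {i j} → Jump (circularDistance m i j) → colour i ≢ colour j
    differ {i} {j} jump eq = <⇒≱ (same-quotient⇒∣-∣< t same-quotient)
      ([ apart jump , (λ c → subst (t ≤_) (∣-∣-comm (coordinate j) _) (apart jump c)) ]′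
        (circularDistance⇒congruent m i j refl))
      where
        same-quotient : coordinate i / t ≡ coordinate j / t
        same-quotient = trans (sym (Fin.toℕ-fromℕ< _)) (trans (cong toℕ eq) (Fin.toℕ-fromℕ< _))

    open Graph (C₂ₙ n a b 0<a a<n 0<b b<n) using (_~_)

    proper : ∀ {i j} → i ~ j → colour i ≢ colour j
    proper (inj₁ a≡d)        = differ (subst Jump a≡d jump-a)
    proper (inj₂ (inj₁ b≡d)) = differ (subst Jump b≡d jump-b)
    proper (inj₂ (inj₂ n≡d)) = differ (subst Jump n≡d jump-n)
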